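{- For every nonnegative integer $n$ let $$R_n=\sum_{k=0}^{n}\binom{n+k}{2k}\binom{2k}{k}\frac{1}{2k-1}.$$ Let $n$ be a positive integer and $p$ an odd prime. Then $$\sum_{k=0}^{n-1}(2k+1)R_k^2 \equiv 0 \pmod{n},$$ and $$\sum_{k=0}^{p-1}(2k+1)R_k^2 \equiv 4p(-1)^{\frac{p-1}{2}} -p^2 \pmod{p^3}.$$
   Context: For every nonnegative integer $k$, $\binom{2k}{k}\frac{1}{2k-1}$ is an integer, so each $R_n$ is an integer. -}

module Defs where

open import Data.Nat as ℕ using (ℕ; zero; suc)
open import Data.Nat.Combinatorics using (_C_)
open import Data.Integer as ℤ using (ℤ; +_; -[1+_])

sumBelow : ℕ → (ℕ → ℤ) → ℤ
sumBelow zero    f = + 0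
sumBelow (suc n) f = sumBelow n f ℤ.+ f n

-- binom(2k,k) / (2k-1) as an integer (exact division; for k = 0 it is 1/(-1) = -1)
centralOver : ℕ → ℤ
centralOver zero    = -[1+ 0 ]
centralOver (suc k) = + (((2 ℕ.* suc k) C (suc k)) ℕ./ (suc (2 ℕ.* k)))

R : ℕ → ℤ
R n = sumBelow (suc n) (λ k → + ((n ℕ.+ k) C (2 ℕ.* k)) ℤ.* centralOver k)

{-# OPTIONS --safe #-}
module Submission where

-- Write A_k(n) = binom(n,k) binom(n+k,k) and let D_n = Σ_k A_k(n) be the central Delannoy numbers.
-- The numbers R_n and D_n are linked by two linear recurrences, of which the second one telescopes
-- in k; together they give, with σ = R_n + R_{n+1},
--   8 Σ_{k≤n} (2k+1) R_k² = (n+1) (8 (n+1) R_n² - (n+1) σ² + 4 σ (R_n + D_n)).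
-- The divisibility by n+1 follows from 4 ∣ σ, which holds because D_n + D_{n+1} is divisible by 4
-- (all Delannoy numbers are odd).  For n + 1 = p an odd prime, the right-hand side is determined
-- modulo p³ by  D_{p-1} ≡ 1 (mod p),  D_{p-1} + D_p ≡ 4 (mod p²)  and
--   R_p + D_p ≡ 2 (1 + 2p) (-1)^((p-1)/2) - 2p (mod p²).
-- In the last one, R_p + D_p = Σ_k 2k A_k(p) / (2k-1), the term with 2k - 1 = p gives the sign, and the
-- terms k and p + 1 - k cancel for 1 < k < p since binom(p-1,j) binom(p+j,j) ≡ (-1)^j (mod p²).

open import Defs
open import Data.Nat as ℕ using (ℕ; zero; suc; _∸_; s≤s; z≤n)
import Data.Nat.Coprimality as ℕ
import Data.Nat.Divisibility as ℕ
import Data.Nat.Properties as ℕ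
open import Data.Nat.Combinatorics using (_C_; nCk+nC[k+1]≡[n+1]C[k+1]; k>n⇒nCk≡0; nCk≡nC[n∸k]; nCn≡1)
open import Data.Nat.DivMod using (m/n*n≡m; m*n/n≡m)
open import Data.Nat.Primality using (Prime; prime⇒irreducible; ¬prime[1])
open import Data.Integer as ℤ using (ℤ; +_; -[1+_]; _+_; _*_; _-_; _^_)
open import Data.Integer.Coprimality using (Coprime; coprime-divisor)
open import Data.Integer.Divisibility using (_∣_)
open import Data.Integer.Divisibility.Signed using (divides; ∣⇒∣ᵤ; ∣ᵤ⇒∣; ∣m∣n⇒∣m+n) renaming (_∣_ to _∣ₛ_)
open import Data.Integer.Properties using (*-cancelˡ-≡; *-zeroʳ; *-zeroˡ; +-inverseʳ; +-identityʳ; +-identityˡ)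
open import Data.Integer.Properties using (pos-*; *-comm; +-assoc; abs-*; ^-distribˡ-+-*)
open import Data.Integer.Tactic.RingSolver using (solve)
open import Data.List using ([]; _∷_)
open import Data.Product using (_×_; _,_; ∃)
open import Data.Sum using (_⊎_; inj₁; inj₂)
open import Relation.Nullary using (contradiction)
open import Relation.Binary.PropositionalEquality using (_≡_; _≢_; refl; sym; trans; cong; cong₂)
open import Relation.Binary.PropositionalEquality using (subst; subst₂; module ≡-Reasoning)


-- An equation follows from known ones once a linear combination of them with explicit coefficients
-- reduces it to a ring identity.
by-comb : ∀ {x y l r : ℤ} c → l ≡ r → x ≡ y + c * (l - r) → x ≡ y
by-comb {y = y} {l} c refl e =
  trans e (trans (cong (λ z → y + c * z) (+-inverseʳ l)) (trans (cong (λ z → y + z) (*-zeroʳ c)) (+-identityʳ y)))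

by-comb₂ : ∀ {x y l r l′ r′ : ℤ} c c′ → l ≡ r → l′ ≡ r′ → x ≡ y + c * (l - r) + c′ * (l′ - r′) → x ≡ y
by-comb₂ c c′ e e′ eq = by-comb c e (by-comb c′ e′ eq)

by-comb₃ : ∀ {x y l r l′ r′ l″ r″ : ℤ} c c′ c″ → l ≡ r → l′ ≡ r′ → l″ ≡ r″ →
           x ≡ y + c * (l - r) + c′ * (l′ - r′) + c″ * (l″ - r″) → x ≡ y
by-comb₃ c c′ c″ e e′ e″ eq = by-comb₂ c c′ e e′ (by-comb c″ e″ eq)

-- Neighbouring binomial coefficients.

binom : ℕ → ℕ → ℤ
binom n k = + (n C k)

pascal : ∀ n k → binom (suc n) (suc k) ≡ binom n k + binom n (suc k)
pascal n k = cong +_ (sym (nCk+nC[k+1]≡[n+1]C[k+1] n k))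

binom-zero : ∀ {n k} → n ℕ.< k → binom n k ≡ + 0
binom-zero n<k = cong +_ (k>n⇒nCk≡0 n<k)

-- Induction on n through Pascal's rule. The ratios of neighbouring binomials below come from this
-- identity, always multiplied out, so that they stay valid where binomials vanish.
absorb : ∀ n k → + suc k * binom (suc n) (suc k) ≡ + suc n * binom n k
absorb zero zero = refl
absorb zero (suc k) = *-zeroʳ (+ suc (suc k))
absorb (suc n) zero = step (+ n) (binom (suc (suc n)) 1) (binom (suc n) 1) (pascal (suc n) 0) (absorb n 0)
  where
  step : ∀ n x y → x ≡ + 1 + y → + 1 * y ≡ (+ 1 + n) * + 1 → + 1 * x ≡ (+ 2 + n) * + 1
  step n x y p q = by-comb₂ (+ 1) (+ 1) p q (solve (n ∷ x ∷ y ∷ []))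
absorb (suc n) (suc k) =
  step (+ n) (+ k) _ _ _ _ _ (pascal (suc n) (suc k)) (absorb n k) (absorb n (suc k)) (pascal n k)
  where
  step : ∀ n k x y z u v → x ≡ y + z → (+ 1 + k) * y ≡ (+ 1 + n) * u →
         (+ 2 + k) * z ≡ (+ 1 + n) * v → y ≡ u + v → (+ 2 + k) * x ≡ (+ 2 + n) * y
  step n k x y z u v p q r s = by-comb₂ (+ 2 + k) (+ 1) p q
    (by-comb₂ (+ 1) (ℤ.- (+ 1 + n)) r s (solve (n ∷ k ∷ x ∷ y ∷ z ∷ u ∷ v ∷ [])))

absorb-pred : ∀ n k → + suc k * binom n (suc k) ≡ (+ n - + k) * binom n k
absorb-pred n k = step (+ n) (+ k) _ _ _ (pascal n k) (absorb n k)
  where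
  step : ∀ n k x y z → x ≡ y + z → (+ 1 + k) * x ≡ (+ 1 + n) * y → (+ 1 + k) * z ≡ (n - k) * y
  step n k x y z p q = by-comb₂ (ℤ.- (+ 1 + k)) (+ 1) p q (solve (n ∷ k ∷ x ∷ y ∷ z ∷ []))

-- Both sides equal (k+1) binom(n+1,k+1).
absorb-row : ∀ n k → (+ suc n - + k) * binom (suc n) k ≡ + suc n * binom n k
absorb-row n k = trans (sym (absorb-pred (suc n) k)) (absorb n k)

-- The products A_k(n) = binom(n,k) binom(n+k,k).

-- The coefficient of ((x-1)/2)^k in the Legendre polynomial P_n(x); the value at x = 3 is the
-- Delannoy number D_n.
legendre : ℕ → ℕ → ℤ
legendre n k = binom n k * binom (n ℕ.+ k) k

legendre-zero : ∀ {n k} → n ℕ.< k → legendre n k ≡ + 0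
legendre-zero {n} {k} n<k = trans (cong (_* binom (n ℕ.+ k) k) (binom-zero n<k)) (*-zeroˡ (binom (n ℕ.+ k) k))

module _ (n k : ℕ) where
  private
    N = + n
    K = + k
    x = binom n k
    y = binom (n ℕ.+ k) k

  -- This and the next two identities serve to write A_{k+1}(n), A_{k+1}(n+1) and A_{k+1}(n+2) as
  -- multiples of the single quantity A_k(n+1) in `R-recurrence`.
  legendre-sucʳ : + suc k * + suc k * legendre n (suc k) ≡ (N - K) * (+ 1 + N + K) * legendre n k
  legendre-sucʳ rewrite ℕ.+-suc n k =
    step N K x (binom n (suc k)) y _ (absorb-pred n k) (absorb (n ℕ.+ k) k)
    where
    step : ∀ n k x x′ y y′ → (+ 1 + k) * x′ ≡ (n - k) * x → (+ 1 + k) * y′ ≡ (+ 1 + (n + k)) * y →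
           (+ 1 + k) * (+ 1 + k) * (x′ * y′) ≡ (n - k) * (+ 1 + n + k) * (x * y)
    step n k x x′ y y′ p q = by-comb₂ ((+ 1 + k) * y′) ((n - k) * x) p q
      (solve (n ∷ k ∷ x ∷ x′ ∷ y ∷ y′ ∷ []))

  private
    up : (+ 1 + N) * binom (suc n ℕ.+ k) k ≡ (+ 1 + N + K) * y
    up = step N K _ y (absorb-row (n ℕ.+ k) k)
      where
      step : ∀ n k z y → (+ 1 + (n + k) - k) * z ≡ (+ 1 + (n + k)) * y → (+ 1 + n) * z ≡ (+ 1 + n + k) * y
      step n k z y p = by-comb (+ 1) p (solve (n ∷ k ∷ z ∷ y ∷ []))

  legendre-suc-suc : + suc k * + suc k * legendre (suc n) (suc k) ≡
                     (+ 2 + N + K) * (+ 1 + N + K) * legendre n k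
  legendre-suc-suc rewrite ℕ.+-suc n k =
    step N K x _ y _ _ (absorb n k) (absorb (suc (n ℕ.+ k)) k) up
    where
    step : ∀ n k x x′ y y′ z → (+ 1 + k) * x′ ≡ (+ 1 + n) * x → (+ 1 + k) * y′ ≡ (+ 2 + (n + k)) * z →
           (+ 1 + n) * z ≡ (+ 1 + n + k) * y →
           (+ 1 + k) * (+ 1 + k) * (x′ * y′) ≡ (+ 2 + n + k) * (+ 1 + n + k) * (x * y)
    step n k x x′ y y′ z p q r =
      by-comb₃ ((+ 1 + k) * y′) ((+ 1 + n) * x) ((+ 2 + (n + k)) * x) p q r
        (solve (n ∷ k ∷ x ∷ x′ ∷ y ∷ y′ ∷ z ∷ []))

  legendre-suc-sucˡ : + suc k * + suc k * legendre n (suc k) ≡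
                      (+ 1 + N - K) * (N - K) * legendre (suc n) k
  legendre-suc-sucˡ = step N K x y _ _ (legendre n (suc k)) (legendre-sucʳ) (absorb-row n k) up
    where
    step : ∀ n k x y x′ z l → (+ 1 + k) * (+ 1 + k) * l ≡ (n - k) * (+ 1 + n + k) * (x * y) →
           (+ 1 + n - k) * x′ ≡ (+ 1 + n) * x → (+ 1 + n) * z ≡ (+ 1 + n + k) * y →
           (+ 1 + k) * (+ 1 + k) * l ≡ (+ 1 + n - k) * (n - k) * (x′ * z)
    step n k x y x′ z l p q r = by-comb₃ (+ 1) (ℤ.- ((n - k) * z)) (ℤ.- ((n - k) * x)) p q r
      (solve (n ∷ k ∷ x ∷ y ∷ x′ ∷ z ∷ l ∷ []))

  -- After multiplication by n+1 the two summands carry the weights n+1-k and n+1+k, which add up to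
  -- 2(n+1).
  legendre-pair : legendre n k + legendre (suc n) k ≡ + 2 * (binom (suc n) k * y)
  legendre-pair = *-cancelˡ-≡ (+ suc n) _ _ (step N K x y _ _ (absorb-row n k) up)
    where
    step : ∀ n k x y x′ z → (+ 1 + n - k) * x′ ≡ (+ 1 + n) * x → (+ 1 + n) * z ≡ (+ 1 + n + k) * y →
           (+ 1 + n) * (x * y + x′ * z) ≡ (+ 1 + n) * (+ 2 * (x′ * y))
    step n k x y x′ z p q = by-comb₂ (ℤ.- y) x′ p q (solve (n ∷ k ∷ x ∷ y ∷ x′ ∷ z ∷ []))

-- Central binomials and the summands of R_n.

central-suc : ∀ k → + suc k * binom (2 ℕ.* suc k) (suc k) ≡ + 2 * (+ 1 + + 2 * + k) * binom (2 ℕ.* k) k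
central-suc k = subst (λ i → + suc k * binom i (suc k) ≡ + 2 * (+ 1 + + 2 * + k) * binom (2 ℕ.* k) k)
  (sym (ℕ.*-suc 2 k))
  (*-cancelˡ-≡ (+ suc k) _ _ (step (+ k) _ _ _ (absorb (suc (2 ℕ.* k)) k) (absorb-row (2 ℕ.* k) k)))
  where
  -- `k + (k + + 0)` is how `2 ℕ.* k` unfolds under `+_`, so the arguments fit without a cast.
  step : ∀ k x y z → (+ 1 + k) * x ≡ (+ 2 + (k + (k + + 0))) * y →
         (+ 1 + (k + (k + + 0)) - k) * y ≡ (+ 1 + (k + (k + + 0))) * z →
         (+ 1 + k) * ((+ 1 + k) * x) ≡ (+ 1 + k) * (+ 2 * (+ 1 + + 2 * k) * z)
  step k x y z p q = by-comb₂ (+ 1 + k) (+ 2 * (+ 1 + k)) p q (solve (k ∷ x ∷ y ∷ z ∷ []))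

even-suc : ∀ n k → (+ 2 + + 2 * + k) * (+ 1 + + 2 * + k) * binom (n ℕ.+ suc k) (2 ℕ.* suc k) ≡
                   (+ n - + k) * (+ 1 + + n + + k) * binom (n ℕ.+ k) (2 ℕ.* k)
even-suc n k = subst₂ (λ i j → (+ 2 + + 2 * + k) * (+ 1 + + 2 * + k) * binom i j ≡
                               (+ n - + k) * (+ 1 + + n + + k) * binom (n ℕ.+ k) (2 ℕ.* k))
  (sym (ℕ.+-suc n k)) (sym (ℕ.*-suc 2 k))
  (step (+ n) (+ k) _ _ _ (absorb (n ℕ.+ k) (suc (2 ℕ.* k))) (absorb-pred (n ℕ.+ k) (2 ℕ.* k)))
  where
  step : ∀ n k x y z → (+ 2 + (k + (k + + 0))) * x ≡ (+ 1 + (n + k)) * y →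
         (+ 1 + (k + (k + + 0))) * y ≡ (n + k - (k + (k + + 0))) * z →
         (+ 2 + + 2 * k) * (+ 1 + + 2 * k) * x ≡ (n - k) * (+ 1 + n + k) * z
  step n k x y z p q = by-comb₂ (+ 1 + + 2 * k) (+ 1 + n + k) p q (solve (n ∷ k ∷ x ∷ y ∷ z ∷ []))

-- Both sides have the same ratio in k and agree at k = 0.
legendre-central : ∀ n k → binom (n ℕ.+ k) (2 ℕ.* k) * binom (2 ℕ.* k) k ≡ legendre n k
legendre-central n zero = refl
legendre-central n (suc k) = *-cancelˡ-≡ (+ suc k) _ _ (*-cancelˡ-≡ (+ suc k) _ _
  (step (+ n) (+ k) _ _ _ _ _ _ (even-suc n k) (central-suc k) (legendre-sucʳ n k) (legendre-central n k)))
  where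
  step : ∀ n k x x′ c c′ l l′ → (+ 2 + + 2 * k) * (+ 1 + + 2 * k) * x′ ≡ (n - k) * (+ 1 + n + k) * x →
         (+ 1 + k) * c′ ≡ + 2 * (+ 1 + + 2 * k) * c →
         (+ 1 + k) * (+ 1 + k) * l′ ≡ (n - k) * (+ 1 + n + k) * l → x * c ≡ l →
         (+ 1 + k) * ((+ 1 + k) * (x′ * c′)) ≡ (+ 1 + k) * ((+ 1 + k) * l′)
  step n k x x′ c c′ l l′ p q r s = by-comb₂ c ((+ 1 + k) * x′) p q
    (by-comb₂ (ℤ.- (+ 1)) ((n - k) * (+ 1 + n + k)) r s (solve (n ∷ k ∷ x ∷ x′ ∷ c ∷ c′ ∷ l ∷ l′ ∷ [])))

-- Since 2 (k + 1) - (2 k + 1) = 1, the quotient is 4 binom(2k,k) - binom(2k+2,k+1).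
centralOver-suc : ∀ k → (+ 1 + + 2 * + k) * centralOver (suc k) ≡ binom (2 ℕ.* suc k) (suc k)
centralOver-suc k = trans (*-comm (+ 1 + + 2 * + k) _)
  (trans (cong (centralOver (suc k) *_) (sym odd))
  (trans (sym (pos-* (N ℕ./ suc (2 ℕ.* k)) (suc (2 ℕ.* k))))
         (cong +_ (m/n*n≡m {N} {suc (2 ℕ.* k)} (∣⇒∣ᵤ {+ suc (2 ℕ.* k)} {c′} (divides (+ 4 * c - c′) eq))))))
  where
  N = (2 ℕ.* suc k) C suc k
  c = binom (2 ℕ.* k) k
  c′ = binom (2 ℕ.* suc k) (suc k)
  odd : + suc (2 ℕ.* k) ≡ + 1 + + 2 * + k
  odd = cong (λ z → + 1 + z) (pos-* 2 k)
  step : ∀ k c c′ → (+ 1 + k) * c′ ≡ + 2 * (+ 1 + + 2 * k) * c → c′ ≡ (+ 4 * c - c′) * (+ 1 + (k + (k + + 0)))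
  step k c c′ p = by-comb (+ 2) p (solve (k ∷ c ∷ c′ ∷ []))
  eq : c′ ≡ (+ 4 * c - c′) * + suc (2 ℕ.* k)
  eq = step (+ k) c c′ (central-suc k)

-- This form includes k = 0, where the factor is -1, and frees the later arguments from division and
-- case distinctions.
centralOver-spec : ∀ k → (+ 2 * + k - + 1) * centralOver k ≡ binom (2 ℕ.* k) k
centralOver-spec zero = refl
centralOver-spec (suc k) = trans (cong (_* centralOver (suc k)) (shift (+ k))) (centralOver-suc k)
  where
  shift : ∀ k → + 2 * (+ 1 + k) - + 1 ≡ + 1 + + 2 * k
  shift k = solve (k ∷ [])

rterm : ℕ → ℕ → ℤ
rterm n k = binom (n ℕ.+ k) (2 ℕ.* k) * centralOver k

legendre-rterm : ∀ n k → legendre n k ≡ (+ 2 * + k - + 1) * rterm n k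
legendre-rterm n k = trans (sym (legendre-central n k)) (step (+ k) (binom (n ℕ.+ k) (2 ℕ.* k)) _ _ (centralOver-spec k))
  where
  step : ∀ k x c o → (+ 2 * k - + 1) * o ≡ c → x * c ≡ (+ 2 * k - + 1) * (x * o)
  step k x c o refl = solve (k ∷ x ∷ o ∷ [])

rterm-zero : ∀ {n k} → n ℕ.< k → rterm n k ≡ + 0
rterm-zero {n} {k} n<k =
  trans (cong (_* centralOver k) (binom-zero {n ℕ.+ k} {2 ℕ.* k} n+k<2k)) (*-zeroˡ (centralOver k))
  where
  n+k<2k : n ℕ.+ k ℕ.< 2 ℕ.* k
  n+k<2k = ℕ.+-mono-<-≤ n<k (ℕ.≤-reflexive (sym (ℕ.+-identityʳ k)))

-- Finite sums.

sumBelow-cong : ∀ n {f g} → (∀ k → f k ≡ g k) → sumBelow n f ≡ sumBelow n g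
sumBelow-cong zero    f≡g = refl
sumBelow-cong (suc n) f≡g = cong₂ _+_ (sumBelow-cong n f≡g) (f≡g n)

sumBelow-+ : ∀ n f g → sumBelow n (λ k → f k + g k) ≡ sumBelow n f + sumBelow n g
sumBelow-+ zero    f g = refl
sumBelow-+ (suc n) f g rewrite sumBelow-+ n f g = step (sumBelow n f) (sumBelow n g) (f n) (g n)
  where
  step : ∀ a b c d → a + b + (c + d) ≡ a + c + (b + d)
  step a b c d = solve (a ∷ b ∷ c ∷ d ∷ [])

sumBelow-* : ∀ n c f → sumBelow n (λ k → c * f k) ≡ c * sumBelow n f
sumBelow-* zero    c f = sym (*-zeroʳ c)
sumBelow-* (suc n) c f rewrite sumBelow-* n c f = step c (sumBelow n f) (f n)
  where
  step : ∀ c a b → c * a + c * b ≡ c * (a + b)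
  step c a b = solve (c ∷ a ∷ b ∷ [])

sumBelow-head : ∀ n f → sumBelow (suc n) f ≡ f 0 + sumBelow n (λ k → f (suc k))
sumBelow-head zero    f = trans (+-identityˡ (f 0)) (sym (+-identityʳ (f 0)))
sumBelow-head (suc n) f rewrite sumBelow-head n f = +-assoc (f 0) _ _

-- Lets the sums for n, n+1 and n+2 run over one common range.
sumBelow-extend : ∀ n f → (∀ {k} → n ℕ.≤ k → f k ≡ + 0) → ∀ d → sumBelow (d ℕ.+ n) f ≡ sumBelow n f
sumBelow-extend n f f≡0 zero    = refl
sumBelow-extend n f f≡0 (suc d)
  rewrite f≡0 (ℕ.m≤n+m n d) = trans (+-identityʳ _) (sumBelow-extend n f f≡0 d)

sumBelow-linear : ∀ n a b c d f g h i →
  sumBelow n (λ k → a * f k + b * g k + c * h k + d * i k) ≡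
  a * sumBelow n f + b * sumBelow n g + c * sumBelow n h + d * sumBelow n i
sumBelow-linear zero a b c d f g h i = solve (a ∷ b ∷ c ∷ d ∷ [])
sumBelow-linear (suc n) a b c d f g h i rewrite sumBelow-linear n a b c d f g h i =
  step (sumBelow n f) (sumBelow n g) (sumBelow n h) (sumBelow n i) (f n) (g n) (h n) (i n)
  where
  step : ∀ s t u v x y z w →
    a * s + b * t + c * u + d * v + (a * x + b * y + c * z + d * w) ≡
    a * (s + x) + b * (t + y) + c * (u + z) + d * (v + w)
  step s t u v x y z w = solve (a ∷ b ∷ c ∷ d ∷ s ∷ t ∷ u ∷ v ∷ x ∷ y ∷ z ∷ w ∷ [])

-- Linear recurrences between R_n and D_n.

D : ℕ → ℤ
D n = sumBelow (suc n) (legendre n)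

R-extend : ∀ n d → sumBelow (d ℕ.+ suc n) (rterm n) ≡ R n
R-extend n d = sumBelow-extend (suc n) (rterm n) rterm-zero d

D-extend : ∀ n d → sumBelow (d ℕ.+ suc n) (legendre n) ≡ D n
D-extend n d = sumBelow-extend (suc n) (legendre n) legendre-zero d

-- Holds term by term. With r_k for `rterm` and A_k = (2k-1) r_k, the k-th terms of the two sides
-- differ by 2 ((n+1-k) r_k(n+1) - (n+1+k) r_k(n)), which is zero by `absorb-row`.
R-step : ∀ n → (+ 1 + + 2 * + n) * R (suc n) - (+ 3 + + 2 * + n) * R n ≡ D n + D (suc n)
R-step n = conclude (+ n) (R (suc n)) (R n) (D n) (D (suc n)) (begin
  a * R (suc n) + b * R n + -[1+ 0 ] * D n + -[1+ 0 ] * D (suc n)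
    ≡⟨ cong₂ (λ x y → a * R (suc n) + b * x + -[1+ 0 ] * y + -[1+ 0 ] * D (suc n))
         (sym (R-extend n 1)) (sym (D-extend n 1)) ⟩
  a * sumBelow M (rterm (suc n)) + b * sumBelow M (rterm n)
    + -[1+ 0 ] * sumBelow M (legendre n) + -[1+ 0 ] * sumBelow M (legendre (suc n))
    ≡⟨ sym (sumBelow-linear M a b -[1+ 0 ] -[1+ 0 ] (rterm (suc n)) (rterm n) (legendre n) (legendre (suc n))) ⟩
  sumBelow M T ≡⟨ vanish M ⟩
  + 0 ∎)
  where
  open ≡-Reasoning
  M = suc (suc n)
  a = + 1 + + 2 * + n
  b = ℤ.- (+ 3 + + 2 * + n)
  T : ℕ → ℤ
  T k = a * rterm (suc n) k + b * rterm n k + -[1+ 0 ] * legendre n k + -[1+ 0 ] * legendre (suc n) k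
  term : ∀ n k x x′ o l l′ → (+ 1 + (n + k) - (k + (k + + 0))) * x′ ≡ (+ 1 + (n + k)) * x →
         l ≡ (+ 2 * k - + 1) * (x * o) → l′ ≡ (+ 2 * k - + 1) * (x′ * o) →
         (+ 1 + + 2 * n) * (x′ * o) + ℤ.- (+ 3 + + 2 * n) * (x * o) + -[1+ 0 ] * l + -[1+ 0 ] * l′ ≡ + 0
  term n k x x′ o l l′ p q r = by-comb₃ (+ 2 * o) -[1+ 0 ] -[1+ 0 ] p q r
    (solve (n ∷ k ∷ x ∷ x′ ∷ o ∷ l ∷ l′ ∷ []))
  T≡0 : ∀ k → T k ≡ + 0
  T≡0 k = term (+ n) (+ k) (binom (n ℕ.+ k) (2 ℕ.* k)) (binom (suc n ℕ.+ k) (2 ℕ.* k)) (centralOver k)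
    (legendre n k) (legendre (suc n) k)
    (absorb-row (n ℕ.+ k) (2 ℕ.* k)) (legendre-rterm n k) (legendre-rterm (suc n) k)
  vanish : ∀ m → sumBelow m T ≡ + 0
  vanish zero = refl
  vanish (suc m) rewrite T≡0 m = trans (+-identityʳ _) (vanish m)
  conclude : ∀ n r′ r d d′ → (+ 1 + + 2 * n) * r′ + ℤ.- (+ 3 + + 2 * n) * r + -[1+ 0 ] * d + -[1+ 0 ] * d′ ≡ + 0 →
             (+ 1 + + 2 * n) * r′ - (+ 3 + + 2 * n) * r ≡ d + d′
  conclude n r′ r d d′ e = by-comb (+ 1) e (solve (n ∷ r′ ∷ r ∷ d ∷ d′ ∷ []))

-- Creative telescoping: the summands up to k of the combined sum `T` add up to -2 A_k(n+1), which
-- vanishes at k = n+2.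
R-recurrence : ∀ n → (+ 2 + + n) * R (suc (suc n)) ≡
                     (+ 7 + + 8 * + n) * R (suc n) - (+ 11 + + 7 * + n) * R n - + 4 * D n
R-recurrence n = conclude (+ n) (R (suc (suc n))) (R (suc n)) (R n) (D n) (begin
  a * R (suc (suc n)) + b * R (suc n) + c * R n + + 4 * D n
    ≡⟨ cong₂ (λ x y → a * R (suc (suc n)) + b * x + c * y + + 4 * D n)
         (sym (R-extend (suc n) 1)) (sym (R-extend n 2)) ⟩
  a * sumBelow M (rterm (suc (suc n))) + b * sumBelow M (rterm (suc n))
    + c * sumBelow M (rterm n) + + 4 * D n
    ≡⟨ cong (λ y → a * sumBelow M (rterm (suc (suc n))) + b * sumBelow M (rterm (suc n))
                   + c * sumBelow M (rterm n) + + 4 * y) (sym (D-extend n 2)) ⟩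
  a * sumBelow M (rterm (suc (suc n))) + b * sumBelow M (rterm (suc n))
    + c * sumBelow M (rterm n) + + 4 * sumBelow M (legendre n)
    ≡⟨ sym (sumBelow-linear M a b c (+ 4) (rterm (suc (suc n))) (rterm (suc n)) (rterm n) (legendre n)) ⟩
  sumBelow M T ≡⟨ telescope (suc (suc n)) ⟩
  -[1+ 1 ] * legendre (suc n) (suc (suc n)) ≡⟨ cong (-[1+ 1 ] *_) (legendre-zero {suc n} (ℕ.n<1+n (suc n))) ⟩
  + 0 ∎)
  where
  open ≡-Reasoning
  M = suc (suc (suc n))
  a = + 2 + + n
  b = ℤ.- (+ 7 + + 8 * + n)
  c = + 11 + + 7 * + n
  T : ℕ → ℤ
  T k = a * rterm (suc (suc n)) k + b * rterm (suc n) k + c * rterm n k + + 4 * legendre n k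
  base : ∀ n → + 0 + ((+ 2 + n) * -[1+ 0 ] + ℤ.- (+ 7 + + 8 * n) * -[1+ 0 ] + (+ 11 + + 7 * n) * -[1+ 0 ] + + 4) ≡ -[1+ 1 ]
  base n = solve (n ∷ [])
  term : ∀ n k α r₂ r₁ r₀ l₂ l₁ l₀ →
    l₂ ≡ (+ 2 * (+ 1 + k) - + 1) * r₂ → l₁ ≡ (+ 2 * (+ 1 + k) - + 1) * r₁ → l₀ ≡ (+ 2 * (+ 1 + k) - + 1) * r₀ →
    (+ 1 + k) * (+ 1 + k) * l₂ ≡ (+ 2 + (+ 1 + n) + k) * (+ 1 + (+ 1 + n) + k) * α →
    (+ 1 + k) * (+ 1 + k) * l₁ ≡ ((+ 1 + n) - k) * (+ 1 + (+ 1 + n) + k) * α →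
    (+ 1 + k) * (+ 1 + k) * l₀ ≡ (+ 1 + n - k) * (n - k) * α →
    (+ 1 + (k + (k + + 0))) * ((+ 1 + k) * ((+ 1 + k) * (-[1+ 1 ] * α + ((+ 2 + n) * r₂ + ℤ.- (+ 7 + + 8 * n) * r₁ + (+ 11 + + 7 * n) * r₀ + + 4 * l₀)))) ≡
    (+ 1 + (k + (k + + 0))) * ((+ 1 + k) * ((+ 1 + k) * (-[1+ 1 ] * l₁)))
  term n k α r₂ r₁ r₀ l₂ l₁ l₀ p₂ p₁ p₀ q₂ q₁ q₀ =
    by-comb₃ (ℤ.- ((+ 1 + k) * (+ 1 + k) * (+ 2 + n))) ((+ 1 + k) * (+ 1 + k) * (+ 7 + + 8 * n))
             (ℤ.- ((+ 1 + k) * (+ 1 + k) * (+ 11 + + 7 * n))) p₂ p₁ p₀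
    (by-comb₃ (+ 2 + n) (+ 2 * (+ 1 + + 2 * k) - (+ 7 + + 8 * n)) (+ 11 + + 7 * n + + 4 * (+ 1 + + 2 * k)) q₂ q₁ q₀
     (solve (n ∷ k ∷ α ∷ r₂ ∷ r₁ ∷ r₀ ∷ l₂ ∷ l₁ ∷ l₀ ∷ [])))
  -- In the induction step everything is multiplied by (k+1)² (2k+1), which turns each term into a
  -- multiple of A_k(n+1).
  telescope : ∀ k → sumBelow (suc k) T ≡ -[1+ 1 ] * legendre (suc n) k
  telescope zero = base (+ n)
  telescope (suc k) rewrite telescope k =
    *-cancelˡ-≡ (+ suc k) _ _ (*-cancelˡ-≡ (+ suc k) _ _ (*-cancelˡ-≡ (+ suc (2 ℕ.* k)) _ _
     (term (+ n) (+ k) (legendre (suc n) k) (rterm (suc (suc n)) (suc k)) (rterm (suc n) (suc k)) (rterm n (suc k))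
       (legendre (suc (suc n)) (suc k)) (legendre (suc n) (suc k)) (legendre n (suc k))
       (legendre-rterm (suc (suc n)) (suc k)) (legendre-rterm (suc n) (suc k)) (legendre-rterm n (suc k))
       (legendre-suc-suc (suc n) k) (legendre-sucʳ (suc n) k) (legendre-suc-sucˡ n k))))
  conclude : ∀ n r₂ r₁ r₀ d → (+ 2 + n) * r₂ + ℤ.- (+ 7 + + 8 * n) * r₁ + (+ 11 + + 7 * n) * r₀ + + 4 * d ≡ + 0 →
             (+ 2 + n) * r₂ ≡ (+ 7 + + 8 * n) * r₁ - (+ 11 + + 7 * n) * r₀ - + 4 * d
  conclude n r₂ r₁ r₀ d e = by-comb (+ 1) e (solve (n ∷ r₂ ∷ r₁ ∷ r₀ ∷ d ∷ []))

-- Closed form of the sum of squares.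

S : ℕ → ℤ
S n = sumBelow n (λ k → + (2 ℕ.* k ℕ.+ 1) * (R k ^ 2))

S-closed : ∀ n → + 8 * S (suc n) ≡ (+ 1 + + n) *
  (+ 8 * (+ 1 + + n) * R n * R n - (+ 1 + + n) * (R n + R (suc n)) * (R n + R (suc n))
   + + 4 * (R n + R (suc n)) * (R n + D n))
S-closed zero = refl
S-closed (suc n) = step (+ n) (S (suc n)) (R n) (R (suc n)) (R (suc (suc n))) (D n) (D (suc n))
  (S-closed n) (R-step n) (R-recurrence n)
  where
  step : ∀ n s r₀ r₁ r₂ d₀ d₁ →
    + 8 * s ≡ (+ 1 + n) * (+ 8 * (+ 1 + n) * r₀ * r₀ - (+ 1 + n) * (r₀ + r₁) * (r₀ + r₁) + + 4 * (r₀ + r₁) * (r₀ + d₀)) →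
    (+ 1 + + 2 * n) * r₁ - (+ 3 + + 2 * n) * r₀ ≡ d₀ + d₁ →
    (+ 2 + n) * r₂ ≡ (+ 7 + + 8 * n) * r₁ - (+ 11 + + 7 * n) * r₀ - + 4 * d₀ →
    + 8 * (s + (+ 1 + n + (+ 1 + n + + 0) + + 1) * (r₁ * (r₁ * + 1))) ≡
    (+ 2 + n) * (+ 8 * (+ 2 + n) * r₁ * r₁ - (+ 2 + n) * (r₁ + r₂) * (r₁ + r₂) + + 4 * (r₁ + r₂) * (r₁ + d₁))
  -- `R-step` eliminates d₁ and `R-recurrence` eliminates (n+2) r₂. The right-hand side is quadratic
  -- in the latter, so the last coefficient is a difference quotient, arising from X² - Y² = (X -
  -- Y)(X + Y).
  step n s r₀ r₁ r₂ d₀ d₁ p q e = by-comb₃ (+ 1)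
    (+ 4 * ((+ 2 + n) * r₁ + ((+ 7 + + 8 * n) * r₁ - (+ 11 + + 7 * n) * r₀ - + 4 * d₀)))
    ((+ 2 + n) * (r₁ + r₂) + ((+ 2 + n) * r₁ + ((+ 7 + + 8 * n) * r₁ - (+ 11 + + 7 * n) * r₀ - + 4 * d₀)) - + 4 * (r₁ + d₁))
    p q e (solve (n ∷ s ∷ r₀ ∷ r₁ ∷ r₂ ∷ d₀ ∷ d₁ ∷ []))

-- Delannoy numbers and divisibility by 4.

-- The Delannoy numbers off the diagonal as well, since the three-term lattice path recurrence
-- leaves the diagonal.
delannoy : ℕ → ℕ → ℤ
delannoy m n = sumBelow (suc m) (λ k → binom m k * binom (n ℕ.+ k) m)

-- Pascal's rule for the second factor splits off `delannoy (suc m) n`. In what is left, Pascal's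
-- rule for the first factor gives the other two sums, one of them after a shift of k.
delannoy-suc-suc : ∀ m n → delannoy (suc m) (suc n) ≡ delannoy (suc m) n + delannoy m n + delannoy m (suc n)
delannoy-suc-suc m n = begin
  delannoy (suc m) (suc n)
    ≡⟨ sumBelow-cong (suc (suc m)) (λ k → step₁ (binom (suc m) k) (binom (suc n ℕ.+ k) (suc m))
         (binom (n ℕ.+ k) m) (binom (n ℕ.+ k) (suc m)) (pascal (n ℕ.+ k) m)) ⟩
  sumBelow (suc (suc m)) (λ k → binom (suc m) k * binom (n ℕ.+ k) m + binom (suc m) k * binom (n ℕ.+ k) (suc m))
    ≡⟨ sumBelow-+ (suc (suc m)) (λ k → binom (suc m) k * binom (n ℕ.+ k) m) _ ⟩
  sumBelow (suc (suc m)) (λ k → binom (suc m) k * binom (n ℕ.+ k) m) + delannoy (suc m) n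
    ≡⟨ cong (λ x → x + delannoy (suc m) n) inner ⟩
  delannoy m n + delannoy m (suc n) + delannoy (suc m) n
    ≡⟨ rearrange (delannoy m n) (delannoy m (suc n)) (delannoy (suc m) n) ⟩
  delannoy (suc m) n + delannoy m n + delannoy m (suc n) ∎
  where
  open ≡-Reasoning
  rearrange : ∀ a b c → a + b + c ≡ c + a + b
  rearrange a b c = solve (a ∷ b ∷ c ∷ [])
  step₁ : ∀ c x y z → x ≡ y + z → c * x ≡ c * y + c * z
  step₁ c x y z refl = solve (c ∷ y ∷ z ∷ [])
  f : ℕ → ℤ
  f k = binom m k * binom (n ℕ.+ k) m
  g : ℕ → ℤ
  g k = binom m k * binom (suc n ℕ.+ k) m
  split : ∀ k → binom (suc m) (suc k) * binom (n ℕ.+ suc k) m ≡ f (suc k) + g k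
  split k = trans (step₂ (binom (n ℕ.+ suc k) m) (binom (suc m) (suc k)) (binom m k) (binom m (suc k)) (pascal m k))
    (cong (λ i → f (suc k) + binom m k * binom i m) (ℕ.+-suc n k))
    where
    step₂ : ∀ c x y z → x ≡ y + z → x * c ≡ z * c + y * c
    step₂ c x y z refl = solve (c ∷ y ∷ z ∷ [])
  f-zero : ∀ {k} → suc m ℕ.≤ k → f k ≡ + 0
  f-zero {k} m<k = trans (cong (_* binom (n ℕ.+ k) m) (binom-zero m<k)) (*-zeroˡ (binom (n ℕ.+ k) m))
  inner : sumBelow (suc (suc m)) (λ k → binom (suc m) k * binom (n ℕ.+ k) m) ≡ delannoy m n + delannoy m (suc n)
  inner = begin
    sumBelow (suc (suc m)) (λ k → binom (suc m) k * binom (n ℕ.+ k) m)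
      ≡⟨ sumBelow-head (suc m) (λ k → binom (suc m) k * binom (n ℕ.+ k) m) ⟩
    f 0 + sumBelow (suc m) (λ k → binom (suc m) (suc k) * binom (n ℕ.+ suc k) m)
      ≡⟨ cong (λ x → f 0 + x) (trans (sumBelow-cong (suc m) split) (sumBelow-+ (suc m) (λ k → f (suc k)) g)) ⟩
    f 0 + (sumBelow (suc m) (λ k → f (suc k)) + delannoy m (suc n))
      ≡⟨ sym (+-assoc (f 0) _ _) ⟩
    f 0 + sumBelow (suc m) (λ k → f (suc k)) + delannoy m (suc n)
      ≡⟨ cong (λ x → x + delannoy m (suc n)) (trans (sym (sumBelow-head (suc m) f)) (sumBelow-extend (suc m) f f-zero 1)) ⟩
    delannoy m n + delannoy m (suc n) ∎

sumBelow-zero : ∀ n {f} → (∀ {k} → k ℕ.< n → f k ≡ + 0) → sumBelow n f ≡ + 0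
sumBelow-zero zero    f≡0 = refl
sumBelow-zero (suc n) f≡0 = cong₂ _+_ (sumBelow-zero n (λ k<n → f≡0 (ℕ.m<n⇒m<1+n k<n))) (f≡0 (ℕ.n<1+n n))

delannoy-0ʳ : ∀ m → delannoy m 0 ≡ + 1
delannoy-0ʳ m = cong₂ _+_
  (sumBelow-zero m (λ {k} k<m → trans (cong (binom m k *_) (binom-zero k<m)) (*-zeroʳ (binom m k))))
  (cong₂ _*_ (cong +_ (nCn≡1 m)) (cong +_ (nCn≡1 m)))

-- The defining sum is not visibly symmetric, but its recurrence and its boundary values are.
delannoy-comm : ∀ m n → delannoy m n ≡ delannoy n m
delannoy-comm zero    zero    = refl
delannoy-comm zero    (suc n) = sym (delannoy-0ʳ (suc n))
delannoy-comm (suc m) zero    = delannoy-0ʳ (suc m)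
delannoy-comm (suc m) (suc n) = begin
  delannoy (suc m) (suc n)
    ≡⟨ delannoy-suc-suc m n ⟩
  delannoy (suc m) n + delannoy m n + delannoy m (suc n)
    ≡⟨ cong₂ _+_ (cong₂ _+_ (delannoy-comm (suc m) n) (delannoy-comm m n)) (delannoy-comm m (suc n)) ⟩
  delannoy n (suc m) + delannoy n m + delannoy (suc n) m
    ≡⟨ rearrange (delannoy n (suc m)) (delannoy n m) (delannoy (suc n) m) ⟩
  delannoy (suc n) m + delannoy n m + delannoy n (suc m)
    ≡⟨ sym (delannoy-suc-suc n m) ⟩
  delannoy (suc n) (suc m) ∎
  where
  open ≡-Reasoning
  rearrange : ∀ a b c → a + b + c ≡ c + b + a
  rearrange a b c = solve (a ∷ b ∷ c ∷ [])

-- The boundary values are 1, and the recurrence adds three odd numbers.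
delannoy-odd : ∀ m n → + 2 ∣ₛ delannoy m n - + 1
delannoy-odd zero    n       = divides (+ 0) refl
delannoy-odd (suc m) zero    = divides (+ 0) (cong (_- + 1) (delannoy-0ʳ (suc m)))
delannoy-odd (suc m) (suc n)
  with delannoy-odd (suc m) n | delannoy-odd m n | delannoy-odd m (suc n)
... | divides q p | divides q′ p′ | divides q″ p″ = divides (+ 1 + q + q′ + q″)
  (step (delannoy (suc m) (suc n)) (delannoy (suc m) n) (delannoy m n) (delannoy m (suc n)) q q′ q″
    (delannoy-suc-suc m n) p p′ p″)
  where
  step : ∀ d a b c q q′ q″ → d ≡ a + b + c → a - + 1 ≡ q * + 2 → b - + 1 ≡ q′ * + 2 → c - + 1 ≡ q″ * + 2 →
         d - + 1 ≡ (+ 1 + q + q′ + q″) * + 2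
  step d a b c q q′ q″ e p p′ p″ = by-comb (+ 1) e (by-comb₃ (+ 1) (+ 1) (+ 1) p p′ p″
    (solve (d ∷ a ∷ b ∷ c ∷ q ∷ q′ ∷ q″ ∷ [])))

D≡delannoy : ∀ n → D n ≡ delannoy n n
D≡delannoy n = sumBelow-cong (suc n) (λ k → cong (λ x → binom n k * + x)
  (trans (nCk≡nC[n∸k] (ℕ.m≤n+m k n)) (cong ((n ℕ.+ k) C_) (ℕ.m+n∸n≡m n k))))

-- By the recurrence and symmetry, D_n + D_{n+1} is twice the sum of the odd numbers `delannoy n n`
-- and `delannoy n (suc n)`.
4∣D+D : ∀ n → + 4 ∣ₛ D n + D (suc n)
4∣D+D n =
  step (D n) (D (suc n)) (delannoy n n) (delannoy (suc n) (suc n)) (delannoy n (suc n)) (delannoy (suc n) n)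
    (D≡delannoy n) (D≡delannoy (suc n)) (delannoy-suc-suc n n) (delannoy-comm (suc n) n)
    (delannoy-odd n n) (delannoy-odd n (suc n))
  where
  step : ∀ d d′ e e′ x y → d ≡ e → d′ ≡ e′ → e′ ≡ y + e + x → y ≡ x →
         + 2 ∣ₛ e - + 1 → + 2 ∣ₛ x - + 1 → + 4 ∣ₛ d + d′
  step d d′ e e′ x y refl refl h refl (divides q p) (divides q′ p′) = divides (+ 1 + q + q′)
    (by-comb₃ (+ 1) (+ 2) (+ 2) h p p′ (solve (e ∷ e′ ∷ x ∷ q ∷ q′ ∷ [])))

-- Since -(2n+3) ≡ 2n+1 (mod 4), `R-step` says that (2n+1)(R_n + R_{n+1}) ≡ 0 (mod 4).
4∣R+R : ∀ n → + 4 ∣ₛ R n + R (suc n)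
4∣R+R n = step (+ n) (R n) (R (suc n)) (D n + D (suc n)) (R-step n) (4∣D+D n)
  where
  -- 2n + 1 is its own inverse modulo 4.
  step : ∀ n r r′ w → (+ 1 + + 2 * n) * r′ - (+ 3 + + 2 * n) * r ≡ w → + 4 ∣ₛ w → + 4 ∣ₛ r + r′
  step n r r′ w p (divides t q) =
    divides ((+ 1 + + 2 * n) * ((+ 1 + n) * r + t) - n * (+ 1 + n) * (r + r′))
      (by-comb₂ (+ 1 + + 2 * n) (+ 1 + + 2 * n) p q (solve (n ∷ r ∷ r′ ∷ w ∷ t ∷ [])))

-- With σ = 4s, every term of the bracket in `S-closed` is a multiple of 8, so the 8 on the left
-- cancels.
n∣S : ∀ n → + suc n ∣ₛ S (suc n)
n∣S n = step (+ n) (S (suc n)) (R n) (R n + R (suc n)) (D n) (S-closed n) (4∣R+R n)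
  where
  step : ∀ n S r σ d →
    + 8 * S ≡ (+ 1 + n) * (+ 8 * (+ 1 + n) * r * r - (+ 1 + n) * σ * σ + + 4 * σ * (r + d)) →
    + 4 ∣ₛ σ → + 1 + n ∣ₛ S
  step n S r σ d e (divides s refl) =
    divides ((+ 1 + n) * r * r - + 2 * (+ 1 + n) * s * s + + 2 * s * (r + d))
      (*-cancelˡ-≡ (+ 8) _ _ (trans e (solve (n ∷ r ∷ d ∷ s ∷ []))))

-- Divisibility tools and signs.

coprime-* : ∀ i j c → Coprime i c → Coprime j c → Coprime (i * j) c
coprime-* i j c i⊥c j⊥c = subst (λ z → ℕ.Coprime z ℤ.∣ c ∣) (sym (abs-* i j)) ij⊥c
  where
  ij⊥c : ℕ.Coprime (ℤ.∣ i ∣ ℕ.* ℤ.∣ j ∣) ℤ.∣ c ∣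
  ij⊥c (d∣ij , d∣c) = j⊥c (ℕ.coprime-divisor (λ (e∣d , e∣i) → i⊥c (e∣i , ℕ.∣-trans e∣d d∣c)) d∣ij , d∣c)

-- Stands in for division by a unit modulo p, p² or p³.
∣-cancelˡ : ∀ {m} c {x} → Coprime m c → m ∣ₛ c * x → m ∣ₛ x
∣-cancelˡ {m} c {x} m⊥c m∣cx = ∣ᵤ⇒∣ (coprime-divisor m c x m⊥c (∣⇒∣ᵤ m∣cx))

sumBelow-∣ : ∀ {d} n {f} → (∀ {k} → k ℕ.< n → d ∣ₛ f k) → d ∣ₛ sumBelow n f
sumBelow-∣ zero    d∣f = divides (+ 0) refl
sumBelow-∣ (suc n) d∣f =
  ∣m∣n⇒∣m+n (sumBelow-∣ n (λ k<n → d∣f (ℕ.m<n⇒m<1+n k<n))) (d∣f (ℕ.n<1+n n))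

-- The terms at i and 2m - i cancel modulo d, which leaves the middle one; the induction peels off
-- both ends at once.
sumBelow-symmetric-∣ : ∀ {d} m f → (∀ i j → i ℕ.+ j ≡ 2 ℕ.* m → i ℕ.< m → d ∣ₛ f i + f j) →
                       d ∣ₛ sumBelow (suc (2 ℕ.* m)) f - f m
sumBelow-symmetric-∣ {d} zero f d∣f = divides (+ 0) (step (f 0))
  where
  step : ∀ x → + 0 + x - x ≡ + 0 * d
  step x = solve (x ∷ d ∷ [])
sumBelow-symmetric-∣ {d} (suc m) f d∣f =
  subst (λ n → d ∣ₛ sumBelow (suc n) f - f (suc m)) (sym (ℕ.*-suc 2 m))
    (step (f 0) (sumBelow (suc (2 ℕ.* m)) (λ k → f (suc k))) (f (2 ℕ.+ 2 ℕ.* m)) (f (suc m)) _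
      (cong (λ x → x + f (2 ℕ.+ 2 ℕ.* m)) (sumBelow-head (suc (2 ℕ.* m)) f))
      (d∣f 0 (2 ℕ.+ 2 ℕ.* m) (sym (ℕ.*-suc 2 m)) (s≤s z≤n))
      (sumBelow-symmetric-∣ m (λ k → f (suc k)) (λ i j i+j≡2m i<m → d∣f (suc i) (suc j)
        (trans (cong suc (trans (ℕ.+-suc i j) (cong suc i+j≡2m))) (sym (ℕ.*-suc 2 m))) (s≤s i<m))))
  where
  step : ∀ a s b c t → t ≡ a + s + b → d ∣ₛ a + b → d ∣ₛ s - c → d ∣ₛ t - c
  step a s b c t refl (divides q p) (divides q′ p′) = divides (q + q′)
    (by-comb₂ (+ 1) (+ 1) p p′ (solve (a ∷ s ∷ b ∷ c ∷ q ∷ q′ ∷ d ∷ [])))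

sg : ℕ → ℤ
sg k = -[1+ 0 ] ^ k

sg-square : ∀ k → sg k * sg k ≡ + 1
sg-square zero    = refl
sg-square (suc k) = trans (step (sg k)) (sg-square k)
  where
  step : ∀ x → (-[1+ 0 ] * x) * (-[1+ 0 ] * x) ≡ x * x
  step x = solve (x ∷ [])

sg-even : ∀ m → sg (2 ℕ.* m) ≡ + 1
sg-even m = trans (^-distribˡ-+-* -[1+ 0 ] m (m ℕ.+ 0))
  (trans (cong (λ k → sg m * sg k) (ℕ.+-identityʳ m)) (sg-square m))

sg-reflect : ∀ i j m → i ℕ.+ j ≡ 2 ℕ.* m → sg j ≡ sg i
sg-reflect i j m i+j≡2m = step (sg i) (sg j)
  (trans (sym (^-distribˡ-+-* -[1+ 0 ] i j)) (trans (cong sg i+j≡2m) (sg-even m))) (sg-square i)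
  where
  step : ∀ x y → x * y ≡ + 1 → x * x ≡ + 1 → y ≡ x
  step x y p q = by-comb₂ x (ℤ.- y) p q (solve (x ∷ y ∷ []))

-- R_p + D_p as a single sum, with p = n + 1.

module _ (n : ℕ) where
  private
    N = + n

  -- `legendre⁺ j` is binom(p-1,j) binom(p+j,j); `legendre⁺⁺ j` is (j+1) A_{j+1}(p) / p;
  -- `halfTerm j` is half of the term k = j+1 of R_p + D_p.
  legendre⁺ legendre⁺⁺ halfTerm : ℕ → ℤ
  legendre⁺ j = binom n j * binom (suc n ℕ.+ j) j
  legendre⁺⁺ j = binom n j * binom (suc n ℕ.+ suc j) (suc j)
  halfTerm j = + suc j * rterm (suc n) (suc j)

  private
    up : ∀ j → (+ 1 + + j) * binom (suc n ℕ.+ suc j) (suc j) ≡ (+ 2 + N + + j) * binom (suc n ℕ.+ j) j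
    up j = trans (cong (λ i → (+ 1 + + j) * binom i (suc j)) (cong suc (ℕ.+-suc n j)))
                 (absorb (suc n ℕ.+ j) j)

  legendre⁺-suc : ∀ j → + suc j * + suc j * legendre⁺ (suc j) ≡ (N - + j) * (+ 2 + N + + j) * legendre⁺ j
  legendre⁺-suc j = step N (+ j) (binom n j) (binom n (suc j)) (binom (suc n ℕ.+ j) j) (binom (suc n ℕ.+ suc j) (suc j))
                 (absorb-pred n j) (up j)
    where
    step : ∀ n k x x′ y y′ → (+ 1 + k) * x′ ≡ (n - k) * x → (+ 1 + k) * y′ ≡ (+ 2 + n + k) * y →
           (+ 1 + k) * (+ 1 + k) * (x′ * y′) ≡ (n - k) * (+ 2 + n + k) * (x * y)
    step n k x x′ y y′ p q = by-comb₂ ((+ 1 + k) * y′) ((n - k) * x) p q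
      (solve (n ∷ k ∷ x ∷ x′ ∷ y ∷ y′ ∷ []))

  legendre⁺⁺-legendre⁺ : ∀ j → + suc j * legendre⁺⁺ j ≡ (+ 2 + N + + j) * legendre⁺ j
  legendre⁺⁺-legendre⁺ j = step N (+ j) (binom n j) (binom (suc n ℕ.+ j) j) (binom (suc n ℕ.+ suc j) (suc j)) (up j)
    where
    step : ∀ n k x y y′ → (+ 1 + k) * y′ ≡ (+ 2 + n + k) * y → (+ 1 + k) * (x * y′) ≡ (+ 2 + n + k) * (x * y)
    step n k x y y′ p = by-comb x p (solve (n ∷ k ∷ x ∷ y ∷ y′ ∷ []))

  -- Exhibits the factor p that comes from binom(p,j+1). For prime p and j < p it is lost only when
  -- 2j+1 = p.
  halfTerm-legendre⁺⁺ : ∀ j → (+ 1 + + 2 * + j) * halfTerm j ≡ + suc n * legendre⁺⁺ j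
  halfTerm-legendre⁺⁺ j = step N (+ j) (rterm (suc n) (suc j)) (binom (suc n) (suc j)) (binom (suc n ℕ.+ suc j) (suc j))
    (binom n j) (legendre-rterm (suc n) (suc j)) (absorb n j)
    where
    step : ∀ n k r x y z → x * y ≡ (+ 2 * (+ 1 + k) - + 1) * r → (+ 1 + k) * x ≡ (+ 1 + n) * z →
           (+ 1 + + 2 * k) * ((+ 1 + k) * r) ≡ (+ 1 + n) * (z * y)
    step n k r x y z p q = by-comb₂ (ℤ.- (+ 1 + k)) y p q (solve (n ∷ k ∷ r ∷ x ∷ y ∷ z ∷ []))

  -- Termwise r_k + (2k-1) r_k = 2k r_k, and the term k = 0 vanishes.
  R+D : R (suc n) + D (suc n) ≡ + 2 * sumBelow (suc n) halfTerm
  R+D = begin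
    R (suc n) + D (suc n)
      ≡⟨ sym (sumBelow-+ (suc (suc n)) (rterm (suc n)) (legendre (suc n))) ⟩
    sumBelow (suc (suc n)) (λ k → rterm (suc n) k + legendre (suc n) k)
      ≡⟨ sumBelow-cong (suc (suc n)) (λ k → step (+ k) (rterm (suc n) k) _ (legendre-rterm (suc n) k)) ⟩
    sumBelow (suc (suc n)) (λ k → + 2 * (+ k * rterm (suc n) k))
      ≡⟨ sumBelow-* (suc (suc n)) (+ 2) (λ k → + k * rterm (suc n) k) ⟩
    + 2 * sumBelow (suc (suc n)) (λ k → + k * rterm (suc n) k)
      ≡⟨ cong (+ 2 *_) (trans (sumBelow-head (suc n) (λ k → + k * rterm (suc n) k))
           (trans (cong (λ z → z + sumBelow (suc n) halfTerm) (*-zeroˡ (rterm (suc n) 0))) (+-identityˡ _))) ⟩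
    + 2 * sumBelow (suc n) halfTerm ∎
    where
    open ≡-Reasoning
    step : ∀ k r l → l ≡ (+ 2 * k - + 1) * r → r + l ≡ + 2 * (k * r)
    step k r l refl = solve (k ∷ r ∷ [])

-- Congruences for a prime p = n + 1.

module _ {n : ℕ} (p-prime : Prime (suc n)) where
  private
    N = + n
    P = + suc n

  coprime-suc : ∀ {k} → k ℕ.< n → Coprime P (+ suc k)
  coprime-suc {k} k<n = ℕ.prime⇒coprime p-prime (s≤s k<n)

  coprime²-suc : ∀ {k} → k ℕ.< n → Coprime (P * P) (+ suc k)
  coprime²-suc {k} k<n = coprime-* P P (+ suc k) (coprime-suc k<n) (coprime-suc k<n)

  -- Consecutive values have the ratio (p² - (j+1)²) / (j+1)², which is -1 modulo p².
  legendre⁺-cong : ∀ {j} → j ℕ.≤ n → P * P ∣ₛ legendre⁺ n j - sg j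
  legendre⁺-cong {zero}  _   = divides (+ 0) refl
  legendre⁺-cong {suc j} j<n = ∣-cancelˡ (+ suc j) c (∣-cancelˡ (+ suc j) c
    (step N (+ j) (legendre⁺ n j) (legendre⁺ n (suc j)) (sg j) (legendre⁺-suc n j) (legendre⁺-cong (ℕ.<⇒≤ j<n))))
    where
    c = coprime²-suc j<n
    step : ∀ n j x y s → (+ 1 + j) * (+ 1 + j) * y ≡ (n - j) * (+ 2 + n + j) * x →
           (+ 1 + n) * (+ 1 + n) ∣ₛ x - s → (+ 1 + n) * (+ 1 + n) ∣ₛ (+ 1 + j) * ((+ 1 + j) * (y - -[1+ 0 ] * s))
    step n j x y s p (divides q e) = divides (x - (+ 1 + j) * (+ 1 + j) * q)
      (by-comb₂ (+ 1) (ℤ.- ((+ 1 + j) * (+ 1 + j))) p e (solve (n ∷ j ∷ x ∷ y ∷ s ∷ q ∷ [])))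

  -- The quotient of `legendre⁺⁺ n j` by `legendre⁺ n j` is (p+j+1) / (j+1), which is 1 modulo p.
  legendre⁺⁺-cong : ∀ {j} → j ℕ.< n → P ∣ₛ legendre⁺⁺ n j - sg j
  legendre⁺⁺-cong {j} j<n = ∣-cancelˡ (+ suc j) (coprime-suc j<n)
    (step N (+ j) (legendre⁺ n j) (legendre⁺⁺ n j) (sg j) (legendre⁺⁺-legendre⁺ n j) (legendre⁺-cong (ℕ.<⇒≤ j<n)))
    where
    step : ∀ n j x y s → (+ 1 + j) * y ≡ (+ 2 + n + j) * x → (+ 1 + n) * (+ 1 + n) ∣ₛ x - s →
           + 1 + n ∣ₛ (+ 1 + j) * (y - s)
    step n j x y s p (divides q e) = divides (x + (+ 1 + j) * (+ 1 + n) * q)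
      (by-comb₂ (+ 1) (+ 1 + j) p e (solve (n ∷ j ∷ x ∷ y ∷ s ∷ q ∷ [])))

  -- For 0 < k < p, k binom(p-1+k,k) = p binom(p-1+k,k-1), so only the term k = 0 survives.
  D-cong : P ∣ₛ D n - + 1
  D-cong = step P (D n) (sumBelow n (λ k → legendre n (suc k))) (sumBelow-head n (legendre n))
    (sumBelow-∣ n (λ {j} j<n → ∣-cancelˡ (+ suc j) (coprime-suc j<n)
      (term N (+ j) (binom n (suc j)) (binom (n ℕ.+ suc j) (suc j)) (binom (n ℕ.+ suc j) j)
        (absorb-pred (n ℕ.+ suc j) j))))
    where
    step : ∀ p d s → d ≡ + 1 + s → p ∣ₛ s → p ∣ₛ d - + 1
    step p d s refl (divides q refl) = divides q (solve (p ∷ q ∷ []))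
    term : ∀ n j x y z → (+ 1 + j) * y ≡ (n + (+ 1 + j) - j) * z → + 1 + n ∣ₛ (+ 1 + j) * (x * y)
    term n j x y z p = divides (x * z) (by-comb x p (solve (n ∷ j ∷ x ∷ y ∷ z ∷ [])))

-- Congruences modulo p² for an odd prime p = 2m + 1.

module _ (m′ : ℕ) (p-prime : Prime (suc (2 ℕ.* suc m′))) where
  private
    m = suc m′
    n = 2 ℕ.* m
    M = + m
    N = + n
    P = + suc n
    ε = sg m

    legendre⁺-last : P * P ∣ₛ legendre⁺ n n - + 1
    legendre⁺-last = subst (λ s → P * P ∣ₛ legendre⁺ n n - s) (sg-even m) (legendre⁺-cong p-prime ℕ.≤-refl)

  -- By `legendre-pair` the sum is 2 Σ binom(p,k) binom(p-1+k,k). For 0 < k < p both factors contain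
  -- p; the ends k = 0 and k = p contribute 1 each.
  D+D-cong : P * P ∣ₛ D n + D (suc n) - + 4
  D+D-cong = step (P * P) (D n + D (suc n)) (sumBelow n (λ k → g (suc k))) (g (suc n)) (legendre⁺ n n)
    sum-eq (sumBelow-∣ n middle) last legendre⁺-last
    where
    g : ℕ → ℤ
    g k = binom (suc n) k * binom (n ℕ.+ k) k
    sum-eq : D n + D (suc n) ≡ + 2 * (+ 1 + sumBelow n (λ k → g (suc k)) + g (suc n))
    sum-eq = begin
      D n + D (suc n)
        ≡⟨ cong (λ x → x + D (suc n)) (sym (D-extend n 1)) ⟩
      sumBelow (suc (suc n)) (legendre n) + D (suc n)
        ≡⟨ sym (sumBelow-+ (suc (suc n)) (legendre n) (legendre (suc n))) ⟩
      sumBelow (suc (suc n)) (λ k → legendre n k + legendre (suc n) k)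
        ≡⟨ sumBelow-cong (suc (suc n)) (legendre-pair n) ⟩
      sumBelow (suc (suc n)) (λ k → + 2 * g k)
        ≡⟨ sumBelow-* (suc (suc n)) (+ 2) g ⟩
      + 2 * (sumBelow (suc n) g + g (suc n))
        ≡⟨ cong (λ x → + 2 * (x + g (suc n))) (sumBelow-head n g) ⟩
      + 2 * (+ 1 + sumBelow n (λ k → g (suc k)) + g (suc n)) ∎
      where open ≡-Reasoning
    term : ∀ n j x y z w → (+ 1 + j) * x ≡ (+ 1 + n) * y → (+ 1 + j) * z ≡ (n + (+ 1 + j) - j) * w →
           (+ 1 + n) * (+ 1 + n) ∣ₛ (+ 1 + j) * ((+ 1 + j) * (x * z))
    term n j x y z w p q = divides (y * w)
      (by-comb₂ ((+ 1 + j) * z) ((+ 1 + n) * y) p q (solve (n ∷ j ∷ x ∷ y ∷ z ∷ w ∷ [])))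
    middle : ∀ {j} → j ℕ.< n → P * P ∣ₛ g (suc j)
    middle {j} j<n = ∣-cancelˡ (+ suc j) (coprime²-suc p-prime j<n) (∣-cancelˡ (+ suc j) (coprime²-suc p-prime j<n)
      (term N (+ j) (binom (suc n) (suc j)) (binom n j) (binom (n ℕ.+ suc j) (suc j)) (binom (n ℕ.+ suc j) j)
        (absorb n j) (absorb-pred (n ℕ.+ suc j) j)))
    -- binom(2p-1,p) = binom(2p-1,p-1), since `absorb-pred` relates them with the same weight p on
    -- both sides.
    last : g (suc n) ≡ legendre⁺ n n
    last = cong₂ _*_ (trans (cong +_ (nCn≡1 (suc n))) (sym (cong +_ (nCn≡1 n))))
      (trans (*-cancelˡ-≡ P _ _ (trans (absorb-pred (n ℕ.+ suc n) n)
        (cong (_* binom (n ℕ.+ suc n) n) (shift N))))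
        (cong (λ i → binom i n) (ℕ.+-suc n n)))
      where
      shift : ∀ n → n + (+ 1 + n) - n ≡ + 1 + n
      shift n = solve (n ∷ [])
    step : ∀ d t s l x → t ≡ + 2 * (+ 1 + s + l) → d ∣ₛ s → l ≡ x → d ∣ₛ x - + 1 → d ∣ₛ t - + 4
    step d t s l x p (divides q e) refl (divides q′ e′) = divides (+ 2 * (q + q′))
      (by-comb₃ (+ 1) (+ 2) (+ 2) p e e′ (solve (d ∷ t ∷ s ∷ l ∷ q ∷ q′ ∷ [])))

  private
    P≡ : P ≡ + 1 + + 2 * M
    P≡ = cong (λ z → + 1 + z) (pos-* 2 m)

  -- Here 2m+1 = p cancels the factor p. The remaining quotient (3m+2)/(m+1) = (1+3p)/(1+p) is 1+2p
  -- modulo p²; 1-p serves as the inverse of 1+p.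
  middle-term : P * P ∣ₛ halfTerm n m - (+ 1 + + 2 * P) * ε
  middle-term = step P M (halfTerm n m) (legendre⁺⁺ n m) (legendre⁺ n m) ε
    P≡ halfTerm≡legendre⁺⁺ (legendre⁺⁺-legendre⁺ n m) (legendre⁺-cong p-prime (ℕ.m≤n*m m 2))
    where
    halfTerm≡legendre⁺⁺ : halfTerm n m ≡ legendre⁺⁺ n m
    halfTerm≡legendre⁺⁺ = *-cancelˡ-≡ P _ _ (trans (cong (_* halfTerm n m) P≡) (halfTerm-legendre⁺⁺ n m))
    step : ∀ p m f v u s → p ≡ + 1 + + 2 * m → f ≡ v → (+ 1 + m) * v ≡ (+ 2 + (m + (m + + 0)) + m) * u →
           p * p ∣ₛ u - s → p * p ∣ₛ f - (+ 1 + + 2 * p) * s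
    step p m f v u s refl refl e (divides q e′) =
      divides (v - + 3 * s + (+ 1 + + 2 * (+ 1 + + 2 * m) - + 3 * (+ 1 + + 2 * m) * (+ 1 + + 2 * m)) * q)
        (by-comb₂ (+ 2 * (+ 1 - (+ 1 + + 2 * m)))
                  (+ 1 + + 2 * (+ 1 + + 2 * m) - + 3 * (+ 1 + + 2 * m) * (+ 1 + + 2 * m)) e e′
          (solve (m ∷ v ∷ u ∷ s ∷ q ∷ [])))

  -- The first term is p(p+1) ≡ p. The last satisfies (2p-1) f = 2p u with u ≡ 1, so f ≡ -2p.
  outer-pair : P * P ∣ₛ halfTerm n 0 + halfTerm n n + P
  outer-pair = step N (halfTerm n 0) (legendre⁺⁺ n 0) (halfTerm n n) (legendre⁺⁺ n n) (legendre⁺ n n)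
    (halfTerm-legendre⁺⁺ n 0) (legendre⁺⁺-legendre⁺ n 0)
    (halfTerm-legendre⁺⁺ n n) (legendre⁺⁺-legendre⁺ n n) legendre⁺-last
    where
    step : ∀ n f₀ v₀ f v u → + 1 * f₀ ≡ (+ 1 + n) * v₀ → + 1 * v₀ ≡ (+ 2 + n + + 0) * + 1 →
           (+ 1 + + 2 * n) * f ≡ (+ 1 + n) * v → (+ 1 + n) * v ≡ (+ 2 + n + n) * u →
           (+ 1 + n) * (+ 1 + n) ∣ₛ u - + 1 → (+ 1 + n) * (+ 1 + n) ∣ₛ f₀ + f + (+ 1 + n)
    step n f₀ v₀ f v u p₀ q₀ p q (divides t e) =
      -- 3 + 2n = 2p+1, and (2p+1)(2p-1) ≡ -1 (mod p²).
      divides (+ 4 * f - + 3 - (+ 3 + + 2 * n) * (+ 2 + + 2 * n) * t)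
        (by-comb₂ (+ 1) (+ 1 + n) p₀ q₀ (by-comb₃ (ℤ.- (+ 3 + + 2 * n)) (ℤ.- (+ 3 + + 2 * n))
          (ℤ.- ((+ 3 + + 2 * n) * (+ 2 + + 2 * n))) p q e
          (solve (n ∷ f₀ ∷ v₀ ∷ f ∷ v ∷ u ∷ t ∷ []))))

  -- The denominators 2k-1 of the two terms add up to 2p, so they are opposite modulo p, while the
  -- numerators are p times the same sign modulo p².
  inner-pair : ∀ i j → suc i ℕ.+ suc j ≡ 2 ℕ.* m → suc i ℕ.< m → P * P ∣ₛ halfTerm n (suc i) + halfTerm n (suc j)
  inner-pair i j i+j≡2m i<m =
    step (+ suc i) (+ suc j) P (halfTerm n (suc i)) (halfTerm n (suc j))
      (legendre⁺⁺ n (suc i)) (legendre⁺⁺ n (suc j)) (sg (suc i))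
      (cong (λ z → + suc z) i+j≡2m) (halfTerm-legendre⁺⁺ n (suc i)) (halfTerm-legendre⁺⁺ n (suc j))
      (legendre⁺⁺-cong p-prime i<n)
      (subst (λ s → P ∣ₛ legendre⁺⁺ n (suc j) - s) (sg-reflect (suc i) (suc j) m i+j≡2m)
        (legendre⁺⁺-cong p-prime j<n))
      coprime
    where
    i<n : suc i ℕ.< n
    i<n = ℕ.≤-trans i<m (ℕ.m≤n*m m 2)
    j<n : suc j ℕ.< n
    j<n = subst (suc j ℕ.<_) i+j≡2m (s≤s (ℕ.m≤n+m (suc j) i))
    coprime : Coprime P (+ 1 + + 2 * + suc i)
    coprime = subst (Coprime P) (cong (λ z → + 1 + z) (pos-* 2 (suc i)))
      (coprime-suc p-prime (ℕ.*-monoʳ-< 2 i<m))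
    step : ∀ i j p a b x y s .{{_ : ℤ.NonZero p}} → + 1 + (i + j) ≡ p → (+ 1 + + 2 * i) * a ≡ p * x →
           (+ 1 + + 2 * j) * b ≡ p * y → p ∣ₛ x - s → p ∣ₛ y - s → Coprime p (+ 1 + + 2 * i) → p * p ∣ₛ a + b
    step i j p a b x y s ij pa pb px py cop = combine p∣a p∣b
      where
      p∣a : p ∣ₛ a
      p∣a = ∣-cancelˡ (+ 1 + + 2 * i) cop (divides x (trans pa (*-comm p x)))
      -- 2j+1 = 2p - (2i+1), so the factor 2i+1 can be cancelled for b as well.
      p∣b : p ∣ₛ b
      p∣b = ∣-cancelˡ (+ 1 + + 2 * i) cop (divides (+ 2 * b - y)
        (by-comb₂ (+ 2 * b) (ℤ.- (+ 1)) ij pb (solve (i ∷ j ∷ p ∷ b ∷ y ∷ []))))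
      combine : p ∣ₛ a → p ∣ₛ b → p * p ∣ₛ a + b
      combine (divides q refl) (divides q′ refl) =
        scale (∣-cancelˡ (+ 1 + + 2 * i) cop (reduced px py))
        where
        x≡ : (+ 1 + + 2 * i) * q ≡ x
        x≡ = *-cancelˡ-≡ p _ _ (by-comb (+ 1) pa (solve (i ∷ p ∷ q ∷ x ∷ [])))
        y≡ : (+ 1 + + 2 * j) * q′ ≡ y
        y≡ = *-cancelˡ-≡ p _ _ (by-comb (+ 1) pb (solve (j ∷ p ∷ q′ ∷ y ∷ [])))
        reduced : p ∣ₛ x - s → p ∣ₛ y - s → p ∣ₛ (+ 1 + + 2 * i) * (q + q′)
        reduced (divides t e) (divides t′ e′) = divides (t - t′ + + 2 * q′)
          (by-comb₃ (+ 1) (ℤ.- (+ 1)) (+ 2 * q′) x≡ y≡ ij (by-comb₂ (+ 1) (ℤ.- (+ 1)) e e′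
            (solve (i ∷ j ∷ p ∷ q ∷ q′ ∷ x ∷ y ∷ s ∷ t ∷ t′ ∷ []))))
        scale : p ∣ₛ q + q′ → p * p ∣ₛ q * p + q′ * p
        scale (divides t e) = divides t (by-comb p e (solve (p ∷ q ∷ q′ ∷ t ∷ [])))

  -- The two outermost terms are split off and account for -p; the other 2m-1 terms are symmetric
  -- about the middle one.
  sum-cong : P * P ∣ₛ sumBelow (suc n) (halfTerm n) - ((+ 1 + + 2 * P) * ε - P)
  sum-cong = subst (λ k → P * P ∣ₛ sumBelow (suc k) (halfTerm n) - ((+ 1 + + 2 * P) * ε - P)) (sym n≡)
    (step (P * P) P (halfTerm n 0) (sumBelow (suc (2 ℕ.* m′)) (λ k → halfTerm n (suc k)))
      (halfTerm n (2 ℕ.+ 2 ℕ.* m′)) (halfTerm n m)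
      ((+ 1 + + 2 * P) * ε) _
      (cong (λ x → x + halfTerm n (2 ℕ.+ 2 ℕ.* m′)) (sumBelow-head (suc (2 ℕ.* m′)) (halfTerm n)))
      (subst (λ k → P * P ∣ₛ halfTerm n 0 + halfTerm n k + P) n≡ outer-pair)
      (sumBelow-symmetric-∣ m′ (λ k → halfTerm n (suc k)) (λ i j i+j≡ i<m′ → inner-pair i j
        (trans (cong suc (trans (ℕ.+-suc i j) (cong suc i+j≡))) (sym n≡)) (s≤s i<m′)))
      middle-term)
    where
    n≡ : n ≡ 2 ℕ.+ 2 ℕ.* m′
    n≡ = ℕ.*-suc 2 m′
    step : ∀ d p a s b c e t → t ≡ a + s + b → d ∣ₛ a + b + p → d ∣ₛ s - c → d ∣ₛ c - e → d ∣ₛ t - (e - p)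
    step d p a s b c e t refl (divides q h) (divides q′ h′) (divides q″ h″) = divides (q + q′ + q″)
      (by-comb₃ (+ 1) (+ 1) (+ 1) h h′ h″ (solve (d ∷ p ∷ a ∷ s ∷ b ∷ c ∷ e ∷ q ∷ q′ ∷ q″ ∷ [])))

  -- The congruence modulo p³.

  -- The closed form determines 8 S modulo p³; the factor 8 is removed as three factors 2, each
  -- coprime to p.
  S-cong : (+ suc n) ^ 3 ∣ₛ S (suc n) - (+ 4 * P * ε - P ^ 2)
  S-cong = subst₂ (λ x y → x ∣ₛ S (suc n) - (+ 4 * P * ε - y)) (cube P) (square P)
    (cancel2 (cancel2 (cancel2 (step N (S (suc n)) (R n) (R (suc n)) (D n) (D (suc n)) (sumBelow (suc n) (halfTerm n)) ε
      (S-closed n) (R-step n) (R+D n) (sg-square m) D+D-cong sum-cong (D-cong p-prime)))))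
    where
    cube : ∀ p → p * p * p ≡ p * (p * (p * + 1))
    cube p = solve (p ∷ [])
    square : ∀ p → p * p ≡ p * (p * + 1)
    square p = solve (p ∷ [])
    p⊥2 : Coprime P (+ 2)
    p⊥2 = coprime-suc p-prime (ℕ.*-monoʳ-≤ 2 {1} {m} (s≤s z≤n))
    cancel2 : ∀ {x} → P * P * P ∣ₛ + 2 * x → P * P * P ∣ₛ x
    cancel2 = ∣-cancelˡ (+ 2) (coprime-* (P * P) P (+ 2) (coprime-* P P (+ 2) p⊥2 p⊥2) p⊥2)
    -- a, σ, g stand for R_{p-1}, R_{p-1} + R_p, R_{p-1} + D_{p-1}. Owing to the outer factor p, it
    -- suffices to know a modulo p and σ, g modulo p².
    final : ∀ p ε α σ₂ g₂ a σ g → ε * ε ≡ + 1 → a ≡ p * α - + 1 - + 2 * ε →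
      σ ≡ p * (+ 8 * ε - + 4 + p * σ₂) - + 4 → g ≡ p * (+ 4 * ε - + 2) + p * p * g₂ - + 2 * ε →
      p * p * p ∣ₛ p * (+ 8 * p * a * a - p * σ * σ + + 4 * σ * g) - + 8 * (+ 4 * p * ε - p * p)
    final p ε α σ₂ g₂ a σ g e refl refl refl = divides
      (+ 8 * p * α * α - + 16 * (+ 1 + + 2 * ε) * α + + 8 * (+ 8 * ε - + 4 + p * σ₂)
        - p * (+ 8 * ε - + 4 + p * σ₂) * (+ 8 * ε - + 4 + p * σ₂)
        + + 4 * σ₂ * (p * (+ 4 * ε - + 2) + p * p * g₂ - + 2 * ε)
        + + 4 * (p * (+ 8 * ε - + 4) - + 4) * g₂ + + 32 * (+ 2 * ε - + 1) * (+ 2 * ε - + 1))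
      (by-comb (ℤ.- (+ 32 * p * p)) e (solve (p ∷ ε ∷ α ∷ σ₂ ∷ g₂ ∷ [])))
    -- With a, b, d, d′ for R_{p-1}, R_p, D_{p-1}, D_p: modulo p², the relation between a and b determines
    -- a + b from b mod p, and then a + d from d + d′ and b + d′; modulo p, b is 2 ε - 3.
    step : ∀ n S a b d d′ F ε →
      + 8 * S ≡ (+ 1 + n) * (+ 8 * (+ 1 + n) * a * a - (+ 1 + n) * (a + b) * (a + b) + + 4 * (a + b) * (a + d)) →
      (+ 1 + + 2 * n) * b - (+ 3 + + 2 * n) * a ≡ d + d′ → b + d′ ≡ + 2 * F → ε * ε ≡ + 1 →
      (+ 1 + n) * (+ 1 + n) ∣ₛ d + d′ - + 4 →
      (+ 1 + n) * (+ 1 + n) ∣ₛ F - ((+ 1 + + 2 * (+ 1 + n)) * ε - (+ 1 + n)) →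
      + 1 + n ∣ₛ d - + 1 →
      (+ 1 + n) * (+ 1 + n) * (+ 1 + n) ∣ₛ + 2 * (+ 2 * (+ 2 * (S - (+ 4 * (+ 1 + n) * ε - (+ 1 + n) * (+ 1 + n)))))
    step n S a b d d′ F ε hS hR hF hε (divides x hx) (divides y hy) (divides z hz) =
      subst ((+ 1 + n) * (+ 1 + n) * (+ 1 + n) ∣ₛ_)
        (sym scaled)
        (final (+ 1 + n) ε α σ₂ g₂ a (a + b) (a + d) hε ha hσ hg)
      where
      scaled : + 2 * (+ 2 * (+ 2 * (S - (+ 4 * (+ 1 + n) * ε - (+ 1 + n) * (+ 1 + n))))) ≡
        (+ 1 + n) * (+ 8 * (+ 1 + n) * a * a - (+ 1 + n) * (a + b) * (a + b) + + 4 * (a + b) * (a + d))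
        - + 8 * (+ 4 * (+ 1 + n) * ε - (+ 1 + n) * (+ 1 + n))
      scaled = by-comb (+ 1) hS (solve (n ∷ S ∷ a ∷ b ∷ d ∷ ε ∷ []))
      β = + 4 * ε - + 2 + + 2 * y * (+ 1 + n) - x * (+ 1 + n) + z
      σ₁ = + 2 * (b - a) - x * (+ 1 + n)
      σ₂ = + 4 * β - + 2 * σ₁ - x
      α = σ₁ - β
      g₂ = σ₂ - + 2 * y + x
      hb : b ≡ + 2 * ε - + 3 + (+ 1 + n) * (+ 4 * ε - + 2 + + 2 * y * (+ 1 + n) - x * (+ 1 + n) + z)
      hb = by-comb (+ 1) hF (by-comb₃ (ℤ.- (+ 1)) (+ 2) (+ 1) hx hy hz
        (solve (n ∷ b ∷ d ∷ d′ ∷ F ∷ ε ∷ x ∷ y ∷ z ∷ [])))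
      -- In terms of p, `R-step` reads (2p-1) b - (2p+1) a = d + d′, and d + d′ = 4 + x p².
      hσ₀ : a + b ≡ (+ 1 + n) * (+ 2 * (b - a) - x * (+ 1 + n)) - + 4
      hσ₀ = by-comb₂ (ℤ.- (+ 1)) (ℤ.- (+ 1)) hR hx (solve (n ∷ a ∷ b ∷ d ∷ d′ ∷ x ∷ []))
      poly : ∀ p ε a b x β → b ≡ + 2 * ε - + 3 + p * β → a + b ≡ p * (+ 2 * (b - a) - x * p) - + 4 →
        + 2 * (b - a) - x * p ≡ + 8 * ε - + 4 + p * (+ 4 * β - + 2 * (+ 2 * (b - a) - x * p) - x)
      poly p ε a b x β h h′ = by-comb₂ (+ 4) (ℤ.- (+ 2)) h h′ (solve (p ∷ ε ∷ a ∷ b ∷ x ∷ β ∷ []))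
      -- Substituting a = p σ₁ - 4 - b gives σ₁ ≡ 4b + 8 (mod p), where b is known modulo p.
      hσ₁ : σ₁ ≡ + 8 * ε - + 4 + (+ 1 + n) * σ₂
      hσ₁ = poly (+ 1 + n) ε a b x β hb hσ₀
      hσ : a + b ≡ (+ 1 + n) * (+ 8 * ε - + 4 + (+ 1 + n) * σ₂) - + 4
      hσ = trans hσ₀ (cong (λ w → (+ 1 + n) * w - + 4) hσ₁)
      ha : a ≡ (+ 1 + n) * α - + 1 - + 2 * ε
      ha = poly-a (+ 1 + n) ε a b σ₁ β hb hσ₀
        where
        poly-a : ∀ p ε a b σ₁ β → b ≡ + 2 * ε - + 3 + p * β → a + b ≡ p * σ₁ - + 4 →
                 a ≡ p * (σ₁ - β) - + 1 - + 2 * ε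
        poly-a p ε a b σ₁ β h h′ = by-comb₂ (ℤ.- (+ 1)) (+ 1) h h′ (solve (p ∷ ε ∷ a ∷ b ∷ σ₁ ∷ β ∷ []))
      hg : a + d ≡ (+ 1 + n) * (+ 4 * ε - + 2) + (+ 1 + n) * (+ 1 + n) * g₂ - + 2 * ε
      hg = poly-g (+ 1 + n) ε a b d x y z σ₂ hb hσ hz
        where
        poly-g : ∀ p ε a b d x y z σ₂ → b ≡ + 2 * ε - + 3 + p * (+ 4 * ε - + 2 + + 2 * y * p - x * p + z) →
                 a + b ≡ p * (+ 8 * ε - + 4 + p * σ₂) - + 4 → d - + 1 ≡ z * p →
                 a + d ≡ p * (+ 4 * ε - + 2) + p * p * (σ₂ - + 2 * y + x) - + 2 * ε
        poly-g p ε a b d x y z σ₂ h h′ h″ = by-comb₃ (ℤ.- (+ 1)) (+ 1) (+ 1) h h′ h″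
          (solve (p ∷ ε ∷ a ∷ b ∷ d ∷ x ∷ y ∷ z ∷ σ₂ ∷ []))

-- Odd primes and conclusion.

even-or-odd : ∀ n → (∃ λ m → n ≡ 2 ℕ.* m) ⊎ (∃ λ m → n ≡ suc (2 ℕ.* m))
even-or-odd zero = inj₁ (0 , refl)
even-or-odd (suc n) with even-or-odd n
... | inj₁ (m , refl) = inj₂ (m , refl)
... | inj₂ (m , refl) = inj₁ (suc m , sym (ℕ.*-suc 2 m))

-- An even prime has the divisor 2, which must be p itself. The half (p-1)/2 appears as a successor,
-- so that two outer terms can be split off in `sum-cong`.
oddPrime : ∀ {p} → Prime p → p ≢ 2 → ∃ λ m → p ≡ suc (2 ℕ.* suc m)
oddPrime {p} p-prime p≢2 with even-or-odd p
... | inj₂ (suc m , p≡) = m , p≡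
... | inj₂ (zero , refl) = contradiction p-prime ¬prime[1]
... | inj₁ (m , refl) with prime⇒irreducible p-prime (ℕ.m∣m*n {2} m)
...   | inj₂ 2≡p = contradiction (sym 2≡p) p≢2

theorem1p1 : (∀ (n : ℕ) → 1 ℕ.≤ n →
    (+ n) ∣ sumBelow n (λ k → + (2 ℕ.* k ℕ.+ 1) * (R k ^ 2)))
    × (∀ (p : ℕ) → Prime p → p ≢ 2 →
    ((+ p) ^ 3) ∣ (sumBelow p (λ k → + (2 ℕ.* k ℕ.+ 1) * (R k ^ 2))
    - (((+ 4) * (+ p) * (-[1+ 0 ] ^ ((p ∸ 1) ℕ./ 2))) - ((+ p) ^ 2))))
theorem1p1 = divisibility , congruence
  where
  divisibility : ∀ n → 1 ℕ.≤ n → + n ∣ S n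
  divisibility (suc n) _ = ∣⇒∣ᵤ {+ suc n} {S (suc n)} (n∣S n)
  congruence : ∀ p → Prime p → p ≢ 2 → (+ p) ^ 3 ∣ (S p - ((+ 4 * + p * sg ((p ∸ 1) ℕ./ 2)) - (+ p) ^ 2))
  congruence p p-prime p≢2 = go (oddPrime p-prime p≢2) p-prime
    where
    go : ∀ {p} → (∃ λ m → p ≡ suc (2 ℕ.* suc m)) → Prime p →
         (+ p) ^ 3 ∣ (S p - ((+ 4 * + p * sg ((p ∸ 1) ℕ./ 2)) - (+ p) ^ 2))
    go {p} (m , refl) p-prime = ∣⇒∣ᵤ {(+ p) ^ 3} (subst
      (λ k → (+ p) ^ 3 ∣ₛ S p - (+ 4 * + p * sg k - (+ p) ^ 2)) (sym half) (S-cong m p-prime))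
      where
      half : (2 ℕ.* suc m) ℕ./ 2 ≡ suc m
      half = trans (cong (ℕ._/ 2) (ℕ.*-comm 2 (suc m))) (m*n/n≡m (suc m) 2)
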